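{- For $n\ge 2$, let $P_n$ be the path on vertices $v_1,\dots,v_n$ with edges $v_iv_{i+1}$ ($1\le i\le n-1$), and let $E_n$ (resp. $O_n$) be the graph obtained from $P_n$ by attaching one pendant vertex $\ell_i$ (adjacent only to $v_i$) to each vertex $v_i$ with $i$ even (resp. $i$ odd). Let $\varphi=(1+\sqrt5)/2$ be the golden ratio. Then $$\zeta(E_n)\asymp \varphi^{\gamma(E_n)}\quad\text{and}\quad \zeta(O_n)\asymp\varphi^{\gamma(O_n)},$$ that is, there exist constants $0<c\le C$ such that for all $n\ge 2$, $c\,\varphi^{\gamma(E_n)}\le \zeta(E_n)\le C\,\varphi^{\gamma(E_n)}$ and $c\,\varphi^{\gamma(O_n)}\le \zeta(O_n)\le C\,\varphi^{\gamma(O_n)}$.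
   Context: For a finite simple graph $G$, a set $D\subseteq V(G)$ is dominating if every vertex of $G$ lies in $D$ or has a neighbor in $D$. The domination number $\gamma(G)$ is the minimum size of a dominating set. The dominion $\zeta(G)$ is the number of dominating sets of $G$ of size $\gamma(G)$. -}

module Defs where

open import Data.Empty using (⊥)
open import Data.Fin.Base using (Fin; toℕ; splitAt)
open import Data.Fin.Properties using (all?; any?)
import Data.Fin.Properties as Fin
open import Data.Fin.Subset as Sub using (Subset; inside; outside; _∈_)
open import Data.Fin.Subset.Properties using (_∈?_)
import Data.Integer.Base as ℤ
import Data.Integer.Properties as ℤ
open import Data.List.Base using (List; []; _∷_; _++_; map; filter; length; allFin; lookup)
open import Data.List.Extrema.Nat using (min)
open import Data.Nat.Base as ℕ using (ℕ; zero; suc)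
import Data.Nat.Divisibility as ℕ using (_∣_; _∣?_)
import Data.Nat.Properties as ℕ
open import Data.Product.Base using (∃; ∃₂; _×_; _,_; proj₁; proj₂)
open import Data.Rational.Base as ℚ using (ℚ; 0ℚ)
open import Data.Rational.Unnormalised.Base as ℚᵘ using (mkℚᵘ)
import Data.Rational.Unnormalised.Properties as ℚᵘ
open import Data.Rational.Solver using (module +-*-Solver)
open import Data.Sum.Base using (_⊎_; inj₁; inj₂; swap)
open import Data.Vec.Base using ([]; _∷_)
open import Relation.Binary.Definitions using (Symmetric; Irreflexive; Decidable)
open import Relation.Binary.PropositionalEquality.Core
  using (_≡_; refl; sym; trans; cong; subst; subst₂)
open import Relation.Nullary.Decidable using (no; ¬?; _×-dec_; _⊎-dec_)
import Relation.Unary as Unary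

record Graph : Set₁ where
  field
    order   : ℕ
    Adj     : Fin order → Fin order → Set
    symm    : Symmetric Adj
    irrefl  : Irreflexive _≡_ Adj
    adj?    : Decidable Adj

  V : Set
  V = Fin order

open Graph

module _ (G : Graph) where

  Dominating : Subset (order G) → Set
  Dominating D = ∀ v → v ∈ D ⊎ ∃ λ u → u ∈ D × Adj G v u

  dominating? : Unary.Decidable Dominating
  dominating? D = all? λ v → (v ∈? D) ⊎-dec any? λ u → (u ∈? D) ×-dec adj? G v u

-- Every subset of Fin n occurs exactly once.
subsets : ∀ n → List (Subset n)
subsets zero    = [] ∷ []
subsets (suc n) = map (inside ∷_) (subsets n) ++ map (outside ∷_) (subsets n)

-- The default value `order G` of the minimum is the size of the
-- dominating set consisting of all vertices, so it never interferes.
γ : Graph → ℕ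
γ G = min (order G) (map Sub.∣_∣ (filter (dominating? G) (subsets (order G))))

ζ : Graph → ℕ
ζ G = length (filter (λ D → dominating? G D ×-dec (Sub.∣ D ∣ ℕ.≟ γ G)) (subsets (order G)))

-- The vertex vᵢ, 1 ≤ i ≤ n, is the element of Fin n with toℕ equal to i - 1.
index : ∀ {n} → Fin n → ℕ
index v = suc (toℕ v)

path : ℕ → Graph
path n = record
  { order  = n
  ; Adj    = λ u v → index v ≡ suc (index u) ⊎ index u ≡ suc (index v)
  ; symm   = swap
  ; irrefl = λ { refl (inj₁ eq) → ℕ.1+n≢n (sym eq) ; refl (inj₂ eq) → ℕ.1+n≢n (sym eq) }
  ; adj?   = λ u v → (index v ℕ.≟ suc (index u)) ⊎-dec (index u ℕ.≟ suc (index v))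
  }

-- One new pendant vertex for each position k of the list S, adjacent only
-- to the vertex at that position.  `splitAt` separates the old vertices
-- (inj₁) from the pendant ones (inj₂).
module _ (G : Graph) (S : List (V G)) where

  PendantAdj : V G ⊎ Fin (length S) → V G ⊎ Fin (length S) → Set
  PendantAdj (inj₁ u) (inj₁ v) = Adj G u v
  PendantAdj (inj₁ u) (inj₂ k) = u ≡ lookup S k
  PendantAdj (inj₂ k) (inj₁ v) = v ≡ lookup S k
  PendantAdj (inj₂ _) (inj₂ _) = ⊥

  private
    symm′ : Symmetric PendantAdj
    symm′ {inj₁ _} {inj₁ _} a = symm G a
    symm′ {inj₁ _} {inj₂ _} a = a
    symm′ {inj₂ _} {inj₁ _} a = a

    irrefl′ : ∀ x → PendantAdj x x → ⊥
    irrefl′ (inj₁ _) a = irrefl G refl a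

    adj?′ : Decidable PendantAdj
    adj?′ (inj₁ u) (inj₁ v) = adj? G u v
    adj?′ (inj₁ u) (inj₂ k) = u Fin.≟ lookup S k
    adj?′ (inj₂ k) (inj₁ v) = v Fin.≟ lookup S k
    adj?′ (inj₂ _) (inj₂ _) = no λ ()

  attachPendants : Graph
  attachPendants = record
    { order  = order G ℕ.+ length S
    ; Adj    = λ x y → PendantAdj (splitAt (order G) x) (splitAt (order G) y)
    ; symm   = λ {x} {y} → symm′ {splitAt (order G) x} {splitAt (order G) y}
    ; irrefl = λ { {x} refl → irrefl′ (splitAt (order G) x) }
    ; adj?   = λ x y → adj?′ (splitAt (order G) x) (splitAt (order G) y)
    }

evenIndexed oddIndexed : ∀ n → List (Fin n)
evenIndexed n = filter (λ v → 2 ℕ.∣? index v) (allFin n)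
oddIndexed  n = filter (λ v → ¬? (2 ℕ.∣? index v)) (allFin n)

E O : ℕ → Graph
E n = attachPendants (path n) (evenIndexed n)
O n = attachPendants (path n) (oddIndexed n)

module Rational where

  open import Data.Rational.Base hiding (_/_)
  open import Data.Rational.Properties
  open +-*-Solver

  fromℕ : ℕ → ℚ
  fromℕ n = ℤ.+ n ℚ./ 1

  fromℕ-suc : ∀ n → fromℕ (suc n) ≡ 1ℚ + fromℕ n
  fromℕ-suc n = toℚᵘ-injective (begin-equality
    toℚᵘ (fromℕ (suc n))                ≃⟨ toℚᵘ-fromℚᵘ (mkℚᵘ (ℤ.+ suc n) 0) ⟩
    mkℚᵘ (ℤ.+ suc n) 0                  ≃⟨ ℚᵘ.*≡* (cong (ℤ._* ℤ.1ℤ) (cong (λ k → ℤ.1ℤ ℤ.+ k) (sym (ℤ.*-identityʳ (ℤ.+ n))))) ⟩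
    ℚᵘ.1ℚᵘ ℚᵘ.+ mkℚᵘ (ℤ.+ n) 0          ≃⟨ ℚᵘ.+-congʳ ℚᵘ.1ℚᵘ (ℚᵘ.≃-sym (toℚᵘ-fromℚᵘ (mkℚᵘ (ℤ.+ n) 0))) ⟩
    toℚᵘ 1ℚ ℚᵘ.+ toℚᵘ (fromℕ n)         ≃⟨ ℚᵘ.≃-sym (toℚᵘ-homo-+ 1ℚ (fromℕ n)) ⟩
    toℚᵘ (1ℚ + fromℕ n)                 ∎)
    where open ℚᵘ.≤-Reasoning

  0≤fromℕ : ∀ n → 0ℚ ≤ fromℕ n
  0≤fromℕ n = nonNegative⁻¹ (fromℕ n) {{normalize-nonNeg n 1}}

  1≤↧*ε : ∀ {ε} → 0ℚ < ε → 1ℚ ≤ fromℕ (↧ₙ ε) * ε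
  1≤↧*ε {ε@(mkℚ (ℤ.+ suc a) d _)} _ = toℚᵘ-cancel-≤ (begin
    ℚᵘ.1ℚᵘ                                 ≤⟨ ℚᵘ.*≤* (ℤ.+≤+ bound) ⟩
    mkℚᵘ (ℤ.+ suc d) 0 ℚᵘ.* toℚᵘ ε         ≃⟨ ℚᵘ.*-congʳ {toℚᵘ ε} (ℚᵘ.≃-sym (toℚᵘ-fromℚᵘ (mkℚᵘ (ℤ.+ suc d) 0))) ⟩
    toℚᵘ (fromℕ (suc d)) ℚᵘ.* toℚᵘ ε       ≃⟨ ℚᵘ.≃-sym (toℚᵘ-homo-* (fromℕ (suc d)) ε) ⟩
    toℚᵘ (fromℕ (suc d) * ε)               ∎)
    where
    open ℚᵘ.≤-Reasoning
    bound : 1 ℕ.* (1 ℕ.* suc d) ℕ.≤ suc d ℕ.* suc a ℕ.* 1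
    bound = subst₂ ℕ._≤_
      (sym (trans (ℕ.*-identityˡ _) (ℕ.*-identityˡ _))) (sym (ℕ.*-identityʳ _))
      (ℕ.m≤m*n (suc d) (suc a))
  1≤↧*ε {mkℚ (ℤ.+ zero) d _} (*<* (ℤ.+<+ ()))
  1≤↧*ε {mkℚ ℤ.-[1+ a ] d _} (*<* ())

  0≤a*b : ∀ {a b} → 0ℚ ≤ a → 0ℚ ≤ b → 0ℚ ≤ a * b
  0≤a*b {a} {b} 0≤a 0≤b = nonNegative⁻¹ (a * b)
    {{nonNeg*nonNeg⇒nonNeg a {{nonNegative 0≤a}} b {{nonNegative 0≤b}}}}

  0≤a*a : ∀ a → 0ℚ ≤ a * a
  0≤a*a a with ≤-total 0ℚ a
  ... | inj₁ 0≤a = 0≤a*b 0≤a 0≤a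
  ... | inj₂ a≤0 = subst (0ℚ ≤_)
    (solve 1 (λ a → (:- a) :* (:- a) := a :* a) refl a)
    (0≤a*b (neg-antimono-≤ a≤0) (neg-antimono-≤ a≤0))

  0≤b-a⇒a≤b : ∀ {a b} → 0ℚ ≤ b - a → a ≤ b
  0≤b-a⇒a≤b {a} {b} h = subst₂ _≤_
    (+-identityˡ a) (solve 2 (λ a b → b :- a :+ a := b) refl a b)
    (+-monoˡ-≤ a h)

  a≤b⇒0≤b-a : ∀ {a b} → a ≤ b → 0ℚ ≤ b - a
  a≤b⇒0≤b-a {a} {b} h = subst (_≤ b - a) (+-inverseʳ a) (+-monoˡ-≤ (- a) h)

  a≤∣a∣ : ∀ a → a ≤ ∣ a ∣
  a≤∣a∣ a with ≤-total 0ℚ a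
  ... | inj₁ 0≤a = ≤-reflexive (sym (0≤p⇒∣p∣≡p 0≤a))
  ... | inj₂ a≤0 = ≤-trans a≤0 (0≤∣p∣ a)

  ≤⇒∣∣≤ : ∀ {a b} → a ≤ b → - a ≤ b → ∣ a ∣ ≤ b
  ≤⇒∣∣≤ {a} a≤b -a≤b with ∣p∣≡p∨∣p∣≡-p a
  ... | inj₁ eq = subst (_≤ _) (sym eq) a≤b
  ... | inj₂ eq = subst (_≤ _) (sym eq) -a≤b

  *-mono-∣∣ : ∀ {a b c d} → ∣ a ∣ ≤ b → ∣ c ∣ ≤ d → ∣ a * c ∣ ≤ b * d
  *-mono-∣∣ {a} {b} {c} {d} ∣a∣≤b ∣c∣≤d = begin
    ∣ a * c ∣        ≡⟨ ∣p*q∣≡∣p∣*∣q∣ a c ⟩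
    ∣ a ∣ * ∣ c ∣    ≤⟨ *-monoˡ-≤-nonNeg ∣ a ∣ {{∣-∣-nonNeg a}} ∣c∣≤d ⟩
    ∣ a ∣ * d        ≤⟨ *-monoʳ-≤-nonNeg d {{nonNegative (≤-trans (0≤∣p∣ c) ∣c∣≤d)}} ∣a∣≤b ⟩
    b * d            ∎
    where open ≤-Reasoning

  halves : ∀ ε → ½ * ε + ½ * ε ≡ ε
  halves = solve 1 (λ ε → con ½ :* ε :+ con ½ :* ε := ε) refl

  0<½*ε : ∀ {ε} → 0ℚ < ε → 0ℚ < ½ * ε
  0<½*ε 0<ε = *-monoʳ-<-pos ½ 0<ε

  divide : ∀ {M ε} → 0ℚ < M → 0ℚ < ε → ∃ λ δ → 0ℚ < δ × M * δ ≡ ε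
  divide {M} {ε} 0<M 0<ε = M⁻¹ * ε , positive⁻¹ (M⁻¹ * ε) {{pos*pos⇒pos M⁻¹ ε}} , (begin-equality
    M * (M⁻¹ * ε)    ≡⟨ *-assoc M M⁻¹ ε ⟨
    M * M⁻¹ * ε      ≡⟨ cong (_* ε) (*-inverseʳ M) ⟩
    1ℚ * ε           ≡⟨ *-identityˡ ε ⟩
    ε                ∎)
    where
    open ≤-Reasoning
    instance
      M>0   = positive 0<M
      ε>0   = positive 0<ε
      M≢0   = pos⇒nonZero M
    M⁻¹ = 1/ M
    instance
      M⁻¹>0 = 1/pos⇒pos M

  *-close : ∀ {a b c d K L δ ε} → 0ℚ < K → 0ℚ < L → (K + L) * δ ≡ ε →
            ∣ a ∣ ≤ K → ∣ d ∣ ≤ L → ∣ a - b ∣ < δ → ∣ c - d ∣ < δ →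
            ∣ a * c - b * d ∣ < ε
  *-close {a} {b} {c} {d} {K} {L} {δ} {ε} 0<K 0<L eq ∣a∣≤K ∣d∣≤L a≈b c≈d = begin-strict
    ∣ a * c - b * d ∣                   ≡⟨ cong ∣_∣ (solve 4 (λ a b c d → a :* c :- b :* d := a :* (c :- d) :+ (a :- b) :* d) refl a b c d) ⟩
    ∣ a * (c - d) + (a - b) * d ∣       ≤⟨ ∣p+q∣≤∣p∣+∣q∣ (a * (c - d)) ((a - b) * d) ⟩
    ∣ a * (c - d) ∣ + ∣ (a - b) * d ∣   ≤⟨ +-mono-≤ (*-mono-∣∣ {a} {K} {c - d} ∣a∣≤K ≤-refl) (*-mono-∣∣ {a - b} ≤-refl ∣d∣≤L) ⟩
    K * ∣ c - d ∣ + ∣ a - b ∣ * L       <⟨ +-mono-< (*-monoʳ-<-pos K {{positive 0<K}} c≈d) (*-monoˡ-<-pos L {{positive 0<L}} a≈b) ⟩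
    K * δ + δ * L                       ≡⟨ solve 3 (λ K L δ → K :* δ :+ δ :* L := (K :+ L) :* δ) refl K L δ ⟩
    (K + L) * δ                         ≡⟨ eq ⟩
    ε                                   ∎
    where open ≤-Reasoning

  2⁻ : ℕ → ℚ
  2⁻ zero    = 1ℚ
  2⁻ (suc n) = 2⁻ n * ½

  0≤2⁻ : ∀ n → 0ℚ ≤ 2⁻ n
  0≤2⁻ zero    = nonNegative⁻¹ 1ℚ
  0≤2⁻ (suc n) = 0≤a*b (0≤2⁻ n) (nonNegative⁻¹ ½)

  [1+n]*2⁻≤1 : ∀ n → fromℕ (suc n) * 2⁻ n ≤ 1ℚ
  [1+n]*2⁻≤1 zero    = ≤-refl
  [1+n]*2⁻≤1 (suc n) = begin
    fromℕ (suc (suc n)) * (2⁻ n * ½)        ≡⟨ cong (_* (2⁻ n * ½)) (fromℕ-suc (suc n)) ⟩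
    (1ℚ + fromℕ (suc n)) * (2⁻ n * ½)       ≤⟨ *-monoʳ-≤-nonNeg (2⁻ n * ½) {{nonNegative (0≤2⁻ (suc n))}} (+-monoˡ-≤ (fromℕ (suc n)) 1≤) ⟩
    (fromℕ (suc n) + fromℕ (suc n)) * (2⁻ n * ½)
      ≡⟨ solve 2 (λ k h → (k :+ k) :* (h :* con ½) := k :* h) refl (fromℕ (suc n)) (2⁻ n) ⟩
    fromℕ (suc n) * 2⁻ n                    ≤⟨ [1+n]*2⁻≤1 n ⟩
    1ℚ                                      ∎
    where
    open ≤-Reasoning
    1≤ : 1ℚ ≤ fromℕ (suc n)
    1≤ = subst (1ℚ ≤_) (sym (fromℕ-suc n)) (+-monoʳ-≤ 1ℚ (0≤fromℕ n))

  fromℕ-mono : ∀ {m n} → m ℕ.≤ n → fromℕ m ≤ fromℕ n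
  fromℕ-mono {n = n} ℕ.z≤n = 0≤fromℕ n
  fromℕ-mono {suc m} {suc n} (ℕ.s≤s m≤n) =
    subst₂ _≤_ (sym (fromℕ-suc m)) (sym (fromℕ-suc n)) (+-monoʳ-≤ 1ℚ (fromℕ-mono m≤n))

  2⁻<ε : ∀ {ε n} → 0ℚ < ε → ↧ₙ ε ℕ.≤ n → 2⁻ n < ε
  2⁻<ε {ε} {n} 0<ε ↧ε≤n = *-cancelˡ-<-nonNeg (fromℕ (suc n)) {{nonNegative (0≤fromℕ (suc n))}} (begin-strict
    fromℕ (suc n) * 2⁻ n   ≤⟨ [1+n]*2⁻≤1 n ⟩
    1ℚ                     ≤⟨ 1≤↧*ε 0<ε ⟩
    fromℕ (↧ₙ ε) * ε       ≤⟨ *-monoʳ-≤-nonNeg ε {{nonNegative (<⇒≤ 0<ε)}} (fromℕ-mono ↧ε≤n) ⟩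
    fromℕ n * ε            ≡⟨ +-identityˡ _ ⟨
    0ℚ + fromℕ n * ε       <⟨ +-monoˡ-< (fromℕ n * ε) 0<ε ⟩
    ε + fromℕ n * ε        ≡⟨ solve 2 (λ k ε → ε :+ k :* ε := (con 1ℚ :+ k) :* ε) refl (fromℕ n) ε ⟩
    (1ℚ + fromℕ n) * ε     ≡⟨ cong (_* ε) (fromℕ-suc n) ⟨
    fromℕ (suc n) * ε      ∎)
    where open ≤-Reasoning

  -- x ↦ x + (5 - x²)/4 fixes √5, maps [2, 3] into itself and
  -- contracts the error 5 - x² there.
  √5-approx : ℕ → ℚ
  √5-approx zero    = 1ℚ + 1ℚ
  √5-approx (suc n) = x + (five - x * x) * (½ * ½)
    where
    x    = √5-approx n
    five = fromℕ 5

  √5-error : ℕ → ℚ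
  √5-error n = fromℕ 5 - √5-approx n * √5-approx n

  2≤√5-approx : ∀ n → fromℕ 2 ≤ √5-approx n
  √5-approx≤3 : ∀ n → √5-approx n ≤ fromℕ 3

  2≤√5-approx zero    = ≤-refl
  2≤√5-approx (suc n) = 0≤b-a⇒a≤b (subst (0ℚ ≤_)
    (solve 1 (λ x → ((x :- con (fromℕ 2)) :+ con 1ℚ) :* (con (fromℕ 3) :- x) :* con (½ * ½)
                 := x :+ (con (fromℕ 5) :- x :* x) :* con (½ * ½) :- con (fromℕ 2)) refl x)
    (0≤a*b (0≤a*b (+-mono-≤ (a≤b⇒0≤b-a (2≤√5-approx n)) (nonNegative⁻¹ 1ℚ))
                  (a≤b⇒0≤b-a (√5-approx≤3 n)))
           (nonNegative⁻¹ (½ * ½))))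
    where x = √5-approx n

  √5-approx≤3 zero    = fromℕ-mono {2} {3} (ℕ.n≤1+n 2)
  √5-approx≤3 (suc n) = 0≤b-a⇒a≤b (subst (0ℚ ≤_)
    (solve 1 (λ x → (x :- con (fromℕ 2)) :* (x :- con (fromℕ 2)) :* con (½ * ½) :+ con (1ℚ - ½ * ½)
                 := con (fromℕ 3) :- (x :+ (con (fromℕ 5) :- x :* x) :* con (½ * ½))) refl x)
    (+-mono-≤ (0≤a*b (0≤a*a (x - fromℕ 2)) (nonNegative⁻¹ (½ * ½))) (nonNegative⁻¹ (1ℚ - ½ * ½))))
    where x = √5-approx n

  ∣√5-error∣≤2⁻ : ∀ n → ∣ √5-error n ∣ ≤ 2⁻ n
  ∣√5-error∣≤2⁻ zero    = ≤-refl
  ∣√5-error∣≤2⁻ (suc n) = subst (λ e → ∣ e ∣ ≤ 2⁻ (suc n)) (sym step)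
    (*-mono-∣∣ (∣√5-error∣≤2⁻ n) (≤⇒∣∣≤ upper lower))
    where
    x = √5-approx n
    e = √5-error n
    ¼ = ½ * ½
    factor = 1ℚ - (x * ¼ + x * ¼) - e * (¼ * ¼)

    step : √5-error (suc n) ≡ e * factor
    step = trans
      (solve 3 (λ s x d → s :- (x :+ d) :* (x :+ d) := s :- x :* x :- (x :* d :+ x :* d) :- d :* d)
        refl (fromℕ 5) x (e * ¼))
      (solve 3 (λ e x q → e :- (x :* (e :* q) :+ x :* (e :* q)) :- (e :* q) :* (e :* q)
                       := e :* (con 1ℚ :- (x :* q :+ x :* q) :- e :* (q :* q)))
        refl e x ¼)

    upper : factor ≤ ½
    upper = 0≤b-a⇒a≤b (subst (0ℚ ≤_)
      (solve 1 (λ x → ((x :- con (fromℕ 2)) :* (con (fromℕ 3) :- x :+ con (fromℕ 3)) :+ con (fromℕ 9)) :* con (¼ * ¼)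
                   := con ½ :- (con 1ℚ :- (x :* con ¼ :+ x :* con ¼) :- (con (fromℕ 5) :- x :* x) :* con (¼ * ¼))) refl x)
      (0≤a*b (+-mono-≤ (0≤a*b (a≤b⇒0≤b-a (2≤√5-approx n))
                              (+-mono-≤ (a≤b⇒0≤b-a (√5-approx≤3 n)) (0≤fromℕ 3)))
                       (0≤fromℕ 9))
             (nonNegative⁻¹ (¼ * ¼))))

    lower : - factor ≤ ½
    lower = 0≤b-a⇒a≤b (subst (0ℚ ≤_)
      (solve 1 (λ x → ((x :- con (fromℕ 4)) :* (x :- con (fromℕ 4)) :+ con (fromℕ 3)) :* con (¼ * ¼)
                   := con ½ :- (:- (con 1ℚ :- (x :* con ¼ :+ x :* con ¼) :- (con (fromℕ 5) :- x :* x) :* con (¼ * ¼)))) refl x)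
      (0≤a*b (+-mono-≤ (0≤a*a (x - fromℕ 4)) (0≤fromℕ 3)) (nonNegative⁻¹ (¼ * ¼))))

  √5-cauchy : ∀ {ε} → 0ℚ < ε → ∃ λ N → ∀ {m n} → N ℕ.≤ m → N ℕ.≤ n →
              ∣ √5-approx m - √5-approx n ∣ < ε
  √5-cauchy {ε} 0<ε = N , λ {m} {n} N≤m N≤n →
    let a = √5-approx m ; b = √5-approx n
        1≤a+b : 1ℚ ≤ a + b
        1≤a+b = ≤-trans (fromℕ-mono {1} {4} (ℕ.s≤s ℕ.z≤n)) (+-mono-≤ (2≤√5-approx m) (2≤√5-approx n))
    in begin-strict
      ∣ a - b ∣                           ≡⟨ *-identityʳ _ ⟨
      ∣ a - b ∣ * 1ℚ                      ≤⟨ *-monoˡ-≤-nonNeg ∣ a - b ∣ {{∣-∣-nonNeg (a - b)}} (≤-trans 1≤a+b (a≤∣a∣ (a + b))) ⟩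
      ∣ a - b ∣ * ∣ a + b ∣               ≡⟨ ∣p*q∣≡∣p∣*∣q∣ (a - b) (a + b) ⟨
      ∣ (a - b) * (a + b) ∣               ≡⟨ cong ∣_∣ (solve 3 (λ s a b → (a :- b) :* (a :+ b)
                                               := (s :- b :* b) :- (s :- a :* a)) refl (fromℕ 5) a b) ⟩
      ∣ √5-error n - √5-error m ∣         ≤⟨ ∣p-q∣≤∣p∣+∣q∣ (√5-error n) (√5-error m) ⟩
      ∣ √5-error n ∣ + ∣ √5-error m ∣     ≤⟨ +-mono-≤ (∣√5-error∣≤2⁻ n) (∣√5-error∣≤2⁻ m) ⟩
      2⁻ n + 2⁻ m                         <⟨ +-mono-< (2⁻<ε 0<½ε N≤n) (2⁻<ε 0<½ε N≤m) ⟩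
      ½ * ε + ½ * ε                       ≡⟨ halves ε ⟩
      ε                                   ∎
    where
    open ≤-Reasoning
    N = ↧ₙ (½ * ε)
    0<½ε = 0<½*ε 0<ε

record ℝ : Set where
  field
    seq    : ℕ → ℚ
    cauchy : ∀ {ε} → 0ℚ ℚ.< ε → ∃ λ N → ∀ {m n} → N ℕ.≤ m → N ℕ.≤ n →
             ℚ.∣ seq m ℚ.- seq n ∣ ℚ.< ε

open ℝ public

infix 4 _<ᴿ_ _≤ᴿ_ _≃ᴿ_

_<ᴿ_ _≤ᴿ_ _≃ᴿ_ : ℝ → ℝ → Set
x <ᴿ y = ∃ λ ε → 0ℚ ℚ.< ε × ∃ λ N → ∀ {n} → N ℕ.≤ n → seq x n ℚ.+ ε ℚ.< seq y n
x ≤ᴿ y = ∀ {ε} → 0ℚ ℚ.< ε → ∃ λ N → ∀ {n} → N ℕ.≤ n → seq x n ℚ.< seq y n ℚ.+ ε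
x ≃ᴿ y = x ≤ᴿ y × y ≤ᴿ x

module _ where

  open import Data.Rational.Base
  open import Data.Rational.Properties
  open +-*-Solver
  open Rational

  fromℚ : ℚ → ℝ
  fromℚ q = record
    { seq    = λ _ → q
    ; cauchy = λ {ε} 0<ε → 0 , λ _ _ → subst (λ d → ∣ d ∣ < ε) (sym (+-inverseʳ q)) 0<ε
    }

  infixl 6 _+ᴿ_
  infixl 7 _*ᴿ_
  infixr 8 _^ᴿ_

  _+ᴿ_ : ℝ → ℝ → ℝ
  seq    (x +ᴿ y) n   = seq x n + seq y n
  cauchy (x +ᴿ y) {ε} 0<ε = N ℕ.⊔ M , λ {m} {n} N⊔M≤m N⊔M≤n →
    let a = seq x m ; b = seq x n ; c = seq y m ; d = seq y n
    in begin-strict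
      ∣ a + c - (b + d) ∣          ≡⟨ cong ∣_∣ (solve 4 (λ a b c d → a :+ c :- (b :+ d) := (a :- b) :+ (c :- d)) refl a b c d) ⟩
      ∣ (a - b) + (c - d) ∣        ≤⟨ ∣p+q∣≤∣p∣+∣q∣ (a - b) (c - d) ⟩
      ∣ a - b ∣ + ∣ c - d ∣        <⟨ +-mono-< (xN (ℕ.m⊔n≤o⇒m≤o N M N⊔M≤m) (ℕ.m⊔n≤o⇒m≤o N M N⊔M≤n))
                                               (yM (ℕ.m⊔n≤o⇒n≤o N M N⊔M≤m) (ℕ.m⊔n≤o⇒n≤o N M N⊔M≤n)) ⟩
      ½ * ε + ½ * ε                ≡⟨ halves ε ⟩
      ε                            ∎
    where
    open ≤-Reasoning
    N  = proj₁ (cauchy x (0<½*ε 0<ε))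
    xN = proj₂ (cauchy x (0<½*ε 0<ε))
    M  = proj₁ (cauchy y (0<½*ε 0<ε))
    yM = proj₂ (cauchy y (0<½*ε 0<ε))

  eventually-bounded : ∀ x → ∃₂ λ K N → 0ℚ < K × ∀ {n} → N ℕ.≤ n → ∣ seq x n ∣ ≤ K
  eventually-bounded x = K , N , 0<K , λ {n} N≤n →
    let a = seq x n in begin
      ∣ a ∣                    ≡⟨ cong ∣_∣ (solve 2 (λ a b → a := b :+ (a :- b)) refl a b) ⟩
      ∣ b + (a - b) ∣          ≤⟨ ∣p+q∣≤∣p∣+∣q∣ b (a - b) ⟩
      ∣ b ∣ + ∣ a - b ∣        ≤⟨ +-monoʳ-≤ ∣ b ∣ (<⇒≤ (xN N≤n ℕ.≤-refl)) ⟩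
      K                        ∎
    where
    open ≤-Reasoning
    0<1 = positive⁻¹ 1ℚ
    N   = proj₁ (cauchy x 0<1)
    xN  = proj₂ (cauchy x 0<1)
    b   = seq x N
    K   = ∣ b ∣ + 1ℚ
    0<K : 0ℚ < K
    0<K = +-mono-≤-< (0≤∣p∣ b) 0<1

  _*ᴿ_ : ℝ → ℝ → ℝ
  seq    (x *ᴿ y) n   = seq x n * seq y n
  cauchy (x *ᴿ y) {ε} 0<ε =
    let K , N₁ , 0<K , ∣x∣≤K = eventually-bounded x
        L , N₂ , 0<L , ∣y∣≤L = eventually-bounded y
        δ , 0<δ , [K+L]*δ≡ε  = divide (+-mono-< 0<K 0<L) 0<ε
        N₃ , x-close         = cauchy x 0<δ
        N₄ , y-close         = cauchy y 0<δ
        N                    = N₁ ℕ.⊔ N₂ ℕ.⊔ (N₃ ℕ.⊔ N₄)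
        N₁⊔N₂≤N              = ℕ.m≤m⊔n (N₁ ℕ.⊔ N₂) (N₃ ℕ.⊔ N₄)
        N₃⊔N₄≤N              = ℕ.m≤n⊔m (N₁ ℕ.⊔ N₂) (N₃ ℕ.⊔ N₄)
        N₁≤N                 = ℕ.≤-trans (ℕ.m≤m⊔n N₁ N₂) N₁⊔N₂≤N
        N₂≤N                 = ℕ.≤-trans (ℕ.m≤n⊔m N₁ N₂) N₁⊔N₂≤N
        N₃≤N                 = ℕ.≤-trans (ℕ.m≤m⊔n N₃ N₄) N₃⊔N₄≤N
        N₄≤N                 = ℕ.≤-trans (ℕ.m≤n⊔m N₃ N₄) N₃⊔N₄≤N
    in N , λ {m} {n} N≤m N≤n →
      *-close {seq x m} {seq x n} {seq y m} {seq y n} 0<K 0<L [K+L]*δ≡ε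
        (∣x∣≤K (ℕ.≤-trans N₁≤N N≤m))
        (∣y∣≤L (ℕ.≤-trans N₂≤N N≤n))
        (x-close (ℕ.≤-trans N₃≤N N≤m) (ℕ.≤-trans N₃≤N N≤n))
        (y-close (ℕ.≤-trans N₄≤N N≤m) (ℕ.≤-trans N₄≤N N≤n))

  _^ᴿ_ : ℝ → ℕ → ℝ
  x ^ᴿ zero  = fromℚ 1ℚ
  x ^ᴿ suc n = x *ᴿ x ^ᴿ n

  fromℕᴿ : ℕ → ℝ
  fromℕᴿ n = fromℚ (fromℕ n)

  0ᴿ : ℝ
  0ᴿ = fromℕᴿ 0

  √5 : ℝ
  √5 = record { seq = √5-approx ; cauchy = √5-cauchy }

  0<√5 : 0ᴿ <ᴿ √5
  0<√5 = 1ℚ , positive⁻¹ 1ℚ , 0 , λ {n} _ →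
    <-≤-trans (*<* (ℤ.+<+ (ℕ.s≤s (ℕ.s≤s ℕ.z≤n)))) (2≤√5-approx n)

  √5*√5≃5 : √5 *ᴿ √5 ≃ᴿ fromℕᴿ 5
  √5*√5≃5 = below , above
    where
    open ≤-Reasoning
    below : √5 *ᴿ √5 ≤ᴿ fromℕᴿ 5
    below {ε} 0<ε = ↧ₙ ε , λ {n} N≤n →
      let a = √5-approx n in begin-strict
      a * a                              ≡⟨ solve 2 (λ s a → a :* a := s :+ (:- (s :- a :* a))) refl (fromℕ 5) a ⟩
      fromℕ 5 + - √5-error n             ≤⟨ +-monoʳ-≤ (fromℕ 5) (a≤∣a∣ (- √5-error n)) ⟩
      fromℕ 5 + ∣ - √5-error n ∣         ≡⟨ cong (fromℕ 5 +_) (∣-p∣≡∣p∣ (√5-error n)) ⟩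
      fromℕ 5 + ∣ √5-error n ∣           <⟨ +-monoʳ-< (fromℕ 5) (≤-<-trans (∣√5-error∣≤2⁻ n) (2⁻<ε 0<ε N≤n)) ⟩
      fromℕ 5 + ε                        ∎
    above : fromℕᴿ 5 ≤ᴿ √5 *ᴿ √5
    above {ε} 0<ε = ↧ₙ ε , λ {n} N≤n →
      let a = √5-approx n in begin-strict
      fromℕ 5                      ≡⟨ solve 2 (λ s a → s := a :* a :+ (s :- a :* a)) refl (fromℕ 5) a ⟩
      a * a + √5-error n           ≤⟨ +-monoʳ-≤ (a * a) (a≤∣a∣ (√5-error n)) ⟩
      a * a + ∣ √5-error n ∣       <⟨ +-monoʳ-< (a * a) (≤-<-trans (∣√5-error∣≤2⁻ n) (2⁻<ε 0<ε N≤n)) ⟩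
      a * a + ε                    ∎

  φ : ℝ
  φ = fromℚ ½ *ᴿ (fromℕᴿ 1 +ᴿ √5)

{-# OPTIONS --safe #-}
module Submission where

-- Let m be the number of pendant vertices.  A dominating set meets each of the
-- m disjoint pairs {root, leaf}, so γ = m, and a minimum dominating set chooses
-- exactly one vertex from each pair and nothing else: it is a word in {0, 1}ᵐ
-- with 1 for "root".  A path vertex lying between two consecutive roots forbids
-- two consecutive zeros; a path vertex beyond the first or last root forces
-- the corresponding end letter to be 1.  Hence ζ lies between the numbers of
-- words without two consecutive zeros with both ends equal to 1 (F_m) and with
-- free ends (F_{m+2}), and these are comparable to φᵐ since φ^{j+1} = F_{j+1} φ + F_j.

open import Defs
open import Data.Bool.Base using (Bool; true; false)
open import Data.Fin.Base using (Fin; zero; suc; toℕ; fromℕ<; splitAt; _↑ˡ_; _↑ʳ_)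
open import Data.Fin.Properties as Fin
  using (toℕ-injective; toℕ-fromℕ<; toℕ<n; splitAt-↑ˡ; splitAt-↑ʳ; splitAt⁻¹-↑ˡ; splitAt⁻¹-↑ʳ; ↑ˡ-injective; ↑ʳ-injective)
open import Data.Fin.Subset as Sub using (Subset; inside; outside; ⁅_⁆; ⊥; _∪_; _∈_; _⊆_)
open import Data.Fin.Subset.Properties
  using (_∈?_; ∉⊥; ∣⊥∣≡0; x∈⁅x⁆; x∈⁅y⁆⇒x≡y; x∈p∪q⁺; x∈p∪q⁻; ∪-identityˡ; p⊆q⇒∣p∣≤∣q∣; p⊂q⇒∣p∣<∣q∣; ⊆-antisym)
import Data.Integer.Base as ℤ
open import Data.List.Base as List using (List; []; _∷_; _++_; map; filter; length; tabulate)
open import Data.List.Extrema.Nat using (min≈v⁺)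
import Data.List.Membership.Propositional as List∈
open import Data.List.Membership.Propositional.Properties
  using (∈-lookup; ∈-map⁺; ∈-map⁻; ∈-++⁺ˡ; ∈-++⁺ʳ; ∈-++⁻; ∈-filter⁺; ∈-filter⁻)
open import Data.List.Properties using (length-map; length-++; filter-accept; filter-reject)
open import Data.List.Relation.Unary.All as All using (All; []; _∷_)
open import Data.List.Relation.Unary.AllPairs using ([]; _∷_)
open import Data.List.Relation.Unary.Any as Any using (here; there)
open import Data.List.Relation.Unary.Any.Properties using (lookup-index)
open import Data.List.Relation.Unary.Unique.Propositional using (Unique)
import Data.List.Relation.Unary.Unique.Propositional.Properties as Unique
open import Data.Nat.Base as ℕ using (ℕ; zero; suc; _+_; _*_; _∸_; _≤_; _<_; z≤n; s≤s)
open import Data.Nat.Divisibility as ℕ using (_∣_; _∣?_; divides-refl; ∣m+n∣m⇒∣n; ∣1⇒≡1)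
import Data.Nat.Properties as ℕ
open import Data.Product.Base using (∃; ∃₂; _×_; _,_; proj₂)
open import Data.Rational.Base using (ℚ; 0ℚ; 1ℚ; ½; ∣_∣; nonNegative; positive)
  renaming (_+_ to _+ℚ_; _*_ to _*ℚ_; _-_ to _-ℚ_; -_ to -ℚ_; _≤_ to _≤ℚ_; _<_ to _<ℚ_; _/_ to _/ℚ_)
import Data.Rational.Properties as ℚ
open import Data.Rational.Solver using (module +-*-Solver)
open import Data.Sum.Base using (_⊎_; inj₁; inj₂)
open import Data.Vec.Base as Vec using (Vec; []; _∷_)
open import Data.Vec.Properties as Vec
  using ([]=⇒lookup; lookup⇒[]=; lookup∘tabulate; tabulate∘lookup; tabulate-cong; lookup-replicate)
open import Function.Base using (_∘_; id)
open import Function.Definitions using (Injective)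
open import Relation.Binary.PropositionalEquality
  using (_≡_; _≢_; refl; sym; trans; cong; cong₂; subst; module ≡-Reasoning)
open import Relation.Nullary using (¬_; yes; no; contradiction; ¬?; decidable-stable)
open import Relation.Nullary.Decidable using (from-yes)
open import Relation.Unary using (Decidable)

open Graph
open Rational
open +-*-Solver using (solve; con; _:+_; _:*_; _:-_; :-_; _:=_)

-- Lists without repetition

lookup-injective : ∀ {A : Set} {xs : List A} → Unique xs → Injective _≡_ _≡_ (List.lookup xs)
lookup-injective (_    ∷ _)  {zero}  {zero}  _  = refl
lookup-injective (x∉xs ∷ _)  {zero}  {suc j} eq = contradiction eq (All.lookup x∉xs (∈-lookup j))
lookup-injective (x∉xs ∷ _)  {suc i} {zero}  eq = contradiction (sym eq) (All.lookup x∉xs (∈-lookup i))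
lookup-injective (_    ∷ xs) {suc i} {suc j} eq = cong suc (lookup-injective xs eq)

-- Sending each index of `xs` to the place where its entry is found in `ys` is an injection of index
-- sets. Both bounds on `ζ` are counted through this.
unique⊆⇒length≤ : ∀ {A : Set} {xs ys : List A} → Unique xs →
                  (∀ {x} → x List∈.∈ xs → x List∈.∈ ys) → length xs ≤ length ys
unique⊆⇒length≤ {xs = xs} {ys} uniq xs⊆ys = Fin.injective⇒≤ {f = position} position-injective
  where
  position : Fin (length xs) → Fin (length ys)
  position i = Any.index (xs⊆ys (∈-lookup i))

  position-injective : Injective _≡_ _≡_ position
  position-injective {i} {j} eq = lookup-injective uniq (trans
    (lookup-index (xs⊆ys (∈-lookup i)))
    (trans (cong (List.lookup ys) eq) (sym (lookup-index (xs⊆ys (∈-lookup j))))))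

subsets-complete : ∀ {n} (p : Subset n) → p List∈.∈ subsets n
subsets-complete []            = here refl
subsets-complete (inside  ∷ p) = ∈-++⁺ˡ (∈-map⁺ (inside ∷_) (subsets-complete p))
subsets-complete (outside ∷ p) = ∈-++⁺ʳ (map (inside ∷_) (subsets _)) (∈-map⁺ (outside ∷_) (subsets-complete p))

subsets-unique : ∀ n → Unique (subsets n)
subsets-unique zero    = [] ∷ []
subsets-unique (suc n) = Unique.++⁺
  (Unique.map⁺ Vec.∷-injectiveʳ (subsets-unique n))
  (Unique.map⁺ Vec.∷-injectiveʳ (subsets-unique n))
  λ (p∈ , q∈) → disjoint (∈-map⁻ (inside ∷_) p∈) (∈-map⁻ (outside ∷_) q∈)
  where
  disjoint : ∀ {p} → ∃ (λ q → q List∈.∈ subsets n × p ≡ inside ∷ q) →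
             ¬ ∃ (λ q → q List∈.∈ subsets n × p ≡ outside ∷ q)
  disjoint (_ , _ , refl) (_ , _ , ())

-- Images of finite families

image : ∀ {m n} → (Fin m → Fin n) → Subset n
image {zero}  f = ⊥
image {suc m} f = ⁅ f zero ⁆ ∪ image (f ∘ suc)

∈-image⁺ : ∀ {m n} (f : Fin m → Fin n) k → f k ∈ image f
∈-image⁺ f zero    = x∈p∪q⁺ (inj₁ (x∈⁅x⁆ (f zero)))
∈-image⁺ f (suc k) = x∈p∪q⁺ {p = ⁅ f zero ⁆} (inj₂ (∈-image⁺ (f ∘ suc) k))

∈-image⁻ : ∀ {m n} (f : Fin m → Fin n) {x} → x ∈ image f → ∃ λ k → x ≡ f k
∈-image⁻ {zero}  f x∈ = contradiction x∈ ∉⊥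
∈-image⁻ {suc m} f x∈ with x∈p∪q⁻ ⁅ f zero ⁆ (image (f ∘ suc)) x∈
... | inj₁ x∈⁅f0⁆ = zero , x∈⁅y⁆⇒x≡y (f zero) x∈⁅f0⁆
... | inj₂ x∈rest = let k , eq = ∈-image⁻ (f ∘ suc) x∈rest in suc k , eq

∣⁅x⁆∪p∣≡1+∣p∣ : ∀ {n} (x : Fin n) (p : Subset n) → ¬ x ∈ p → Sub.∣ ⁅ x ⁆ ∪ p ∣ ≡ suc Sub.∣ p ∣
∣⁅x⁆∪p∣≡1+∣p∣ zero    (inside  ∷ p) x∉p = contradiction Vec.here x∉p
∣⁅x⁆∪p∣≡1+∣p∣ zero    (outside ∷ p) x∉p = cong (suc ∘ Sub.∣_∣) (∪-identityˡ p)
∣⁅x⁆∪p∣≡1+∣p∣ (suc x) (inside  ∷ p) x∉p = cong suc (∣⁅x⁆∪p∣≡1+∣p∣ x p (x∉p ∘ Vec.there))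
∣⁅x⁆∪p∣≡1+∣p∣ (suc x) (outside ∷ p) x∉p = ∣⁅x⁆∪p∣≡1+∣p∣ x p (x∉p ∘ Vec.there)

∣image∣ : ∀ {m n} (f : Fin m → Fin n) → Injective _≡_ _≡_ f → Sub.∣ image f ∣ ≡ m
∣image∣ {zero} {n} f inj = ∣⊥∣≡0 n
∣image∣ {suc m} f inj = trans
  (∣⁅x⁆∪p∣≡1+∣p∣ (f zero) (image (f ∘ suc)) (λ f0∈ → contradiction (inj (proj₂ (∈-image⁻ (f ∘ suc) f0∈))) λ ()))
  (cong suc (∣image∣ (f ∘ suc) (Fin.suc-injective ∘ inj)))

⊆∧∣∣≡⇒≡ : ∀ {n} {p q : Subset n} → p ⊆ q → Sub.∣ p ∣ ≡ Sub.∣ q ∣ → p ≡ q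
⊆∧∣∣≡⇒≡ {p = p} {q} p⊆q eq = ⊆-antisym p⊆q q⊆p
  where
  q⊆p : q ⊆ p
  q⊆p {x} x∈q with x ∈? p
  ... | yes x∈p = x∈p
  ... | no  x∉p = contradiction eq (ℕ.<⇒≢ (p⊂q⇒∣p∣<∣q∣ (p⊆q , x , x∈q , x∉p)))

-- Graphs with pendant vertices

module _ (G : Graph) (S : List (V G)) (S-injective : Injective _≡_ _≡_ (List.lookup S)) where

  private
    n m : ℕ
    n = order G
    m = length S

    H : Graph
    H = attachPendants G S

    base : Fin n → V H
    base v = v ↑ˡ m

    leaf : Fin m → V H
    leaf k = n ↑ʳ k

    root : Fin m → V H
    root k = base (List.lookup S k)

    base≢leaf : ∀ {v k} → base v ≢ leaf k
    base≢leaf {v} {k} eq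
      with () ← trans (sym (splitAt-↑ˡ n v m)) (trans (cong (splitAt n) eq) (splitAt-↑ʳ n m k))

  choose : Bool → Fin m → V H
  choose true  k = root k
  choose false k = leaf k

  -- This is the disjointness of the pairs: `splitAt` separates roots from leaves, and `S-injective`
  -- keeps two pendants from sharing a root.
  choose-injective : ∀ b c {i j} → choose b i ≡ choose c j → b ≡ c × i ≡ j
  choose-injective true  true  eq = refl , S-injective (↑ˡ-injective m _ _ eq)
  choose-injective true  false eq = contradiction eq base≢leaf
  choose-injective false true  eq = contradiction (sym eq) base≢leaf
  choose-injective false false eq = refl , ↑ʳ-injective n _ _ eq

  transversal : Vec Bool m → Subset (n + m)
  transversal x = image λ k → choose (Vec.lookup x k) k

  ∈-transversal⁺ : ∀ x {b k} → Vec.lookup x k ≡ b → choose b k ∈ transversal x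
  ∈-transversal⁺ x {k = k} refl = ∈-image⁺ (λ k → choose (Vec.lookup x k) k) k

  ∈-transversal⁻ : ∀ x {b k} → choose b k ∈ transversal x → Vec.lookup x k ≡ b
  ∈-transversal⁻ x {b} {k} ∈x with ∈-image⁻ (λ k → choose (Vec.lookup x k) k) ∈x
  ... | j , eq with refl , refl ← choose-injective b (Vec.lookup x j) eq = refl

  ∣transversal∣ : ∀ x → Sub.∣ transversal x ∣ ≡ m
  ∣transversal∣ x = ∣image∣ _ λ {i} {j} eq → proj₂ (choose-injective (Vec.lookup x i) (Vec.lookup x j) eq)

  transversal-injective : ∀ {x y} → transversal x ≡ transversal y → x ≡ y
  transversal-injective {x} {y} eq = trans (sym (tabulate∘lookup x)) (trans
    (tabulate-cong (λ k → sym (∈-transversal⁻ y (subst (_ ∈_) eq (∈-transversal⁺ x {k = k} refl)))))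
    (tabulate∘lookup y))

  trace : Subset (n + m) → Vec Bool m
  trace D = Vec.tabulate λ k → Vec.lookup D (root k)

  -- The only neighbour of a leaf is its root, so a dominating set that misses `root k` must contain
  -- `leaf k`, the vertex that the trace then selects.
  transversal-trace⊆ : ∀ {D} → Dominating H D → transversal (trace D) ⊆ D
  transversal-trace⊆ {D} dom u∈ with ∈-image⁻ (λ k → choose (Vec.lookup (trace D) k) k) u∈
  ... | k , refl rewrite lookup∘tabulate (λ k → Vec.lookup D (root k)) k
    with Vec.lookup D (root k) in root∈?
  ... | true  = lookup⇒[]= (root k) D root∈?
  ... | false with dom (leaf k)
  ... | inj₁ leaf∈D = leaf∈D
  ... | inj₂ (u , u∈D , adj) rewrite splitAt-↑ʳ n m k with splitAt n u in eq
  -- A neighbour of `leaf k` can only be `root k`, which lies outside `D` in this branch.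
  ... | inj₁ v with refl ← adj with refl ← splitAt⁻¹-↑ˡ {n} eq
    with () ← trans (sym ([]=⇒lookup u∈D)) root∈?

  dominating⇒m≤∣∣ : ∀ {D} → Dominating H D → m ≤ Sub.∣ D ∣
  dominating⇒m≤∣∣ {D} dom = subst (_≤ Sub.∣ D ∣) (∣transversal∣ (trace D))
    (p⊆q⇒∣p∣≤∣q∣ (transversal-trace⊆ dom))

  -- The inclusion `transversal-trace⊆` now holds between sets of the same size `m`.
  minimum⇒transversal : ∀ {D} → Dominating H D → Sub.∣ D ∣ ≡ m → D ≡ transversal (trace D)
  minimum⇒transversal {D} dom ∣D∣≡m =
    sym (⊆∧∣∣≡⇒≡ (transversal-trace⊆ dom) (trans (∣transversal∣ (trace D)) (sym ∣D∣≡m)))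

  -- In a transversal each root and its leaf are dominated by whichever of the two is chosen. Only
  -- path-side vertices without a pendant constrain `x`, and only chosen roots can dominate them.
  Covering : Vec Bool m → Set
  Covering x = ∀ v → (∃ λ k → v ≡ List.lookup S k) ⊎
                     (∃ λ k → Vec.lookup x k ≡ true × Adj G v (List.lookup S k))

  covering⇒dominating : ∀ x → Covering x → Dominating H (transversal x)
  covering⇒dominating x cov u with splitAt n u in eq
  ... | inj₂ k with refl ← splitAt⁻¹-↑ʳ {n} eq with Vec.lookup x k in xₖ
  ... | false = inj₁ (∈-transversal⁺ x xₖ)
  ... | true  = inj₂ (root k , ∈-transversal⁺ x xₖ , leaf-root)
    where
    leaf-root : PendantAdj G S (inj₂ k) (splitAt n (root k))
    leaf-root rewrite splitAt-↑ˡ n (List.lookup S k) m = refl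
  covering⇒dominating x cov u | inj₁ v with refl ← splitAt⁻¹-↑ˡ {n} eq with cov v
  ... | inj₂ (k , xₖ , adj) = inj₂ (root k , ∈-transversal⁺ x xₖ , base-root)
    where
    base-root : PendantAdj G S (inj₁ v) (splitAt n (root k))
    base-root rewrite splitAt-↑ˡ n (List.lookup S k) m = adj
  ... | inj₁ (k , refl) with Vec.lookup x k in xₖ
  ... | true  = inj₁ (∈-transversal⁺ x xₖ)
  ... | false = inj₂ (leaf k , ∈-transversal⁺ x xₖ , root-leaf)
    where
    root-leaf : PendantAdj G S (inj₁ (List.lookup S k)) (splitAt n (leaf k))
    root-leaf rewrite splitAt-↑ʳ n m k = refl

  dominating⇒covering : ∀ x → Dominating H (transversal x) → Covering x
  dominating⇒covering x dom v with dom (base v)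
  ... | inj₁ v∈ with ∈-image⁻ (λ k → choose (Vec.lookup x k) k) v∈
  ...   | k , eq with Vec.lookup x k
  ...     | true  = inj₁ (k , ↑ˡ-injective m _ _ eq)
  ...     | false = contradiction eq base≢leaf
  dominating⇒covering x dom v | inj₂ (u , u∈ , adj)
    with ∈-image⁻ (λ k → choose (Vec.lookup x k) k) u∈
  ... | k , refl rewrite splitAt-↑ˡ n v m with Vec.lookup x k in xₖ
  ...   | true  rewrite splitAt-↑ˡ n (List.lookup S k) m = inj₂ (k , xₖ , adj)
  -- A vertex dominated by a leaf is the root of that leaf.
  ...   | false rewrite splitAt-↑ʳ n m k = inj₁ (k , adj)

  γ≡m : ∀ x → Covering x → γ H ≡ m
  γ≡m x cov = min≈v⁺
    (subst (List∈._∈ map Sub.∣_∣ (filter (dominating? H) (subsets (n + m)))) (∣transversal∣ x)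
      (∈-map⁺ Sub.∣_∣ (∈-filter⁺ (dominating? H) (subsets-complete (transversal x)) (covering⇒dominating x cov))))
    (All.tabulate λ ∈sizes → bound (∈-map⁻ Sub.∣_∣ ∈sizes))
    -- The default value in `γ` is the order `n + m`, which does not undercut `m`.
    (ℕ.m≤n+m m n)
    where
    bound : ∀ {s} → ∃ (λ D → D List∈.∈ filter (dominating? H) (subsets (n + m)) × s ≡ Sub.∣ D ∣) → m ≤ s
    bound (D , D∈ , refl) = dominating⇒m≤∣∣ (proj₂ (∈-filter⁻ (dominating? H) {xs = subsets (n + m)} D∈))

  module _ (γ≡ : γ H ≡ m) where

    length≤ζ : ∀ {xs} → Unique xs → (∀ x → x List∈.∈ xs → Covering x) → length xs ≤ ζ H
    length≤ζ {xs} uniq cov = subst (_≤ ζ H) (length-map transversal xs)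
      (unique⊆⇒length≤ (Unique.map⁺ transversal-injective uniq) λ D∈ → minimum (∈-map⁻ transversal D∈))
      where
      minimum : ∀ {D} → ∃ (λ x → x List∈.∈ xs × D ≡ transversal x) → D List∈.∈ filter _ (subsets (n + m))
      minimum (x , x∈xs , refl) = ∈-filter⁺ _ (subsets-complete (transversal x))
        (covering⇒dominating x (cov x x∈xs) , trans (∣transversal∣ x) (sym γ≡))

    -- Every set counted by `ζ` is the transversal of its own trace, and that trace is covering,
    -- hence listed.
    ζ≤length : ∀ {xs} → (∀ x → Covering x → x List∈.∈ xs) → ζ H ≤ length xs
    ζ≤length {xs} complete = subst (ζ H ≤_) (length-map transversal xs)
      (unique⊆⇒length≤ (Unique.filter⁺ _ (subsets-unique (n + m))) λ D∈ →
        listed (proj₂ (∈-filter⁻ _ {xs = subsets (n + m)} D∈)))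
      where
      listed : ∀ {D} → Dominating H D × Sub.∣ D ∣ ≡ γ H → D List∈.∈ map transversal xs
      listed {D} (dom , ∣D∣≡γ) = subst (List∈._∈ map transversal xs) (sym D≡)
        (∈-map⁺ transversal (complete (trace D) (dominating⇒covering (trace D) (subst (Dominating H) D≡ dom))))
        where D≡ = minimum⇒transversal dom (trans ∣D∣≡γ γ≡)

-- Words over {0, 1} without two consecutive zeros

-- Here and in the end conditions, indices are compared through `toℕ`: this fits the arithmetic of
-- positions on the path and makes the conditions vacuous on the empty word.
NoGap : ∀ {m} → Vec Bool m → Set
NoGap {m} x = ∀ {i j : Fin m} → toℕ j ≡ suc (toℕ i) → Vec.lookup x i ≡ true ⊎ Vec.lookup x j ≡ true

FirstTrue LastTrue : ∀ {m} → Vec Bool m → Set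
FirstTrue {m} x = ∀ {i : Fin m} → toℕ i ≡ 0 → Vec.lookup x i ≡ true
LastTrue  {m} x = ∀ {i : Fin m} → suc (toℕ i) ≡ m → Vec.lookup x i ≡ true

noGap-true∷ : ∀ {m} {x : Vec Bool m} → NoGap x → NoGap (true ∷ x)
noGap-true∷ noGap {zero}          _  = inj₁ refl
noGap-true∷ noGap {suc i} {suc j} eq = noGap (ℕ.suc-injective eq)

noGap-false∷true∷ : ∀ {m} {x : Vec Bool m} → NoGap x → NoGap (false ∷ true ∷ x)
noGap-false∷true∷ noGap {zero}  {suc zero} _  = inj₂ refl
noGap-false∷true∷ noGap {suc i} {suc j}    eq = noGap-true∷ noGap (ℕ.suc-injective eq)

noGap-tail : ∀ {m b} {x : Vec Bool m} → NoGap (b ∷ x) → NoGap x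
noGap-tail noGap eq = noGap (cong suc eq)

fib : ℕ → ℕ
fib 0             = 0
fib 1             = 1
fib (suc (suc n)) = fib (suc n) + fib n

fib≤fib-suc : ∀ n → fib n ≤ fib (suc n)
fib≤fib-suc zero    = z≤n
fib≤fib-suc (suc n) = ℕ.m≤m+n (fib (suc n)) (fib n)

-- The base list holds the admissible last letters.
words : List (Vec Bool 1) → ∀ m → List (Vec Bool m)
words base 0             = [] ∷ []
words base 1             = base
words base (suc (suc m)) =
  map (true ∷_) (words base (suc m)) ++ map (λ x → false ∷ true ∷ x) (words base m)

freeEnd trueEnd : List (Vec Bool 1)
freeEnd = (true ∷ []) ∷ (false ∷ []) ∷ []
trueEnd = (true ∷ []) ∷ []

-- Splitting by the prefix 1 or 01 gives the Fibonacci recurrence. The two choices of `base` differ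
-- only in the initial counts, 1, 2 and 1, 1, hence in the shift of the index of `fib`.
length-words-suc : ∀ base m → length (words base (suc (suc m))) ≡
                   length (words base (suc m)) + length (words base m)
length-words-suc base m = trans
  (length-++ (map (true ∷_) (words base (suc m))))
  (cong₂ _+_ (length-map (true ∷_) (words base (suc m))) (length-map _ (words base m)))

length-freeEnd : ∀ m → length (words freeEnd m) ≡ fib (2 + m)
length-freeEnd 0             = refl
length-freeEnd 1             = refl
length-freeEnd (suc (suc m)) = trans (length-words-suc freeEnd m)
  (cong₂ _+_ (length-freeEnd (suc m)) (length-freeEnd m))

length-trueEnd : ∀ m → length (words trueEnd m) ≡ fib (suc m)
length-trueEnd 0             = refl
length-trueEnd 1             = refl
length-trueEnd (suc (suc m)) = trans (length-words-suc trueEnd m)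
  (cong₂ _+_ (length-trueEnd (suc m)) (length-trueEnd m))

words-unique : ∀ {base} → Unique base → ∀ m → Unique (words base m)
words-unique uniq 0 = [] ∷ []
words-unique uniq 1 = uniq
words-unique {base} uniq (suc (suc m)) = Unique.++⁺
  (Unique.map⁺ Vec.∷-injectiveʳ (words-unique uniq (suc m)))
  (Unique.map⁺ (Vec.∷-injectiveʳ ∘ Vec.∷-injectiveʳ) (words-unique uniq m))
  λ (x∈ , y∈) → disjoint (∈-map⁻ (true ∷_) x∈) (∈-map⁻ (λ x → false ∷ true ∷ x) y∈)
  where
  disjoint : ∀ {x} → ∃ (λ y → y List∈.∈ words base (suc m) × x ≡ true ∷ y) →
             ¬ ∃ (λ y → y List∈.∈ words base m × x ≡ false ∷ true ∷ y)
  disjoint (_ , _ , refl) (_ , _ , ())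

-- Completeness, for the upper count: from length two on, a word without gaps begins with 1 or with
-- 01.
noGap⇒∈freeEnd : ∀ {m} (x : Vec Bool m) → NoGap x → x List∈.∈ words freeEnd m
noGap⇒∈freeEnd []                _ = here refl
noGap⇒∈freeEnd (true  ∷ [])        _ = here refl
noGap⇒∈freeEnd (false ∷ [])        _ = there (here refl)
noGap⇒∈freeEnd (true  ∷ b ∷ x)     noGap = ∈-++⁺ˡ (∈-map⁺ (true ∷_) (noGap⇒∈freeEnd (b ∷ x) (noGap-tail noGap)))
noGap⇒∈freeEnd (false ∷ true ∷ x)  noGap =
  ∈-++⁺ʳ (map (true ∷_) (words freeEnd _)) (∈-map⁺ _ (noGap⇒∈freeEnd x (noGap-tail (noGap-tail noGap))))
noGap⇒∈freeEnd (false ∷ false ∷ x) noGap with noGap {zero} {suc zero} refl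
... | inj₁ ()
... | inj₂ ()

-- Soundness, for the lower count: both prefixes end in 1, so prepending one creates no gap, and
-- over the empty tail it supplies the last letter 1.
∈trueEnd⇒noGap×lastTrue : ∀ {m} {x : Vec Bool m} → x List∈.∈ words trueEnd m → NoGap x × LastTrue x
∈trueEnd⇒noGap×lastTrue {0} _ = (λ { {()} }) , λ { {()} }
∈trueEnd⇒noGap×lastTrue {1} (here refl) = (λ { {zero} {zero} () }) , λ { {zero} _ → refl }
∈trueEnd⇒noGap×lastTrue {suc (suc m)} x∈ with ∈-++⁻ (map (true ∷_) (words trueEnd (suc m))) x∈
... | inj₁ x∈₁ with y , y∈ , refl ← ∈-map⁻ (true ∷_) x∈₁ =
  let noGap , last = ∈trueEnd⇒noGap×lastTrue y∈
  in noGap-true∷ noGap , λ { {suc i} eq → last (ℕ.suc-injective eq) }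
... | inj₂ x∈₂ with y , y∈ , refl ← ∈-map⁻ (λ x → false ∷ true ∷ x) x∈₂ =
  let noGap , last = ∈trueEnd⇒noGap×lastTrue y∈
  in noGap-false∷true∷ noGap ,
     λ { {suc zero} _ → refl ; {suc (suc i)} eq → last (ℕ.suc-injective (ℕ.suc-injective eq)) }

-- The first letter is fixed to 1. The empty list at length 0 makes the count agree with `fib 0`.
trueEnds : ∀ m → List (Vec Bool m)
trueEnds zero    = []
trueEnds (suc m) = map (true ∷_) (words trueEnd m)

length-trueEnds : ∀ m → length (trueEnds m) ≡ fib m
length-trueEnds zero    = refl
length-trueEnds (suc m) = trans (length-map _ (words trueEnd m)) (length-trueEnd m)

trueEnds-unique : ∀ m → Unique (trueEnds m)
trueEnds-unique zero    = []
trueEnds-unique (suc m) = Unique.map⁺ Vec.∷-injectiveʳ (words-unique ([] ∷ []) m)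

∈trueEnds⇒ : ∀ {m} {x : Vec Bool m} → x List∈.∈ trueEnds m → FirstTrue x × NoGap x × LastTrue x
∈trueEnds⇒ {suc m} x∈ with y , y∈ , refl ← ∈-map⁻ (true ∷_) x∈ =
  let noGap , last = ∈trueEnd⇒noGap×lastTrue y∈
  in (λ { {zero} _ → refl }) , noGap-true∷ noGap ,
     λ { {zero} _ → refl ; {suc i} eq → last (ℕ.suc-injective eq) }

-- Choosing all the roots is the witness that `γ≡length` uses for attaining size `m`.
allTrue-ends : ∀ m → let x = Vec.replicate m true in FirstTrue x × NoGap x × LastTrue x
allTrue-ends m = (λ {i} _ → lookup-replicate i true) , (λ {i} _ → inj₁ (lookup-replicate i true)) ,
                 λ {i} _ → lookup-replicate i true

-- Every other vertex of a path

halve : ∀ n → ∃ λ k → n ≡ k * 2 ⊎ n ≡ suc (k * 2)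
halve zero    = 0 , inj₁ refl
halve (suc n) with halve n
... | k , inj₁ eq = k , inj₂ (cong suc eq)
... | k , inj₂ eq = suc k , inj₁ (cong suc eq)

1+i*2≢k*2 : ∀ i k → suc (i * 2) ≢ k * 2
1+i*2≢k*2 (suc i) (suc k) eq = 1+i*2≢k*2 i k (ℕ.suc-injective (ℕ.suc-injective eq))

-- The positions s, s + 2, s + 4, … of a path on n vertices, up to its end.
data Spaced {n} : ℕ → List (Fin n) → Set where
  []  : ∀ {s} → n ≤ s → s ≤ suc n → Spaced s []
  _∷_ : ∀ {s v S} → toℕ v ≡ s → Spaced (2 + s) S → Spaced s (v ∷ S)

-- The first two hypotheses make `P` alternate along the path, and `f` lists the `k` vertices from
-- position `s` on. Since `P` holds at `s`, the filter keeps one vertex and drops the next, so the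
-- recursion goes in steps of two.
filter-spaced : ∀ {n} {P : Fin n → Set} (P? : Decidable P) →
                (∀ {u v} → toℕ v ≡ suc (toℕ u) → P u → ¬ P v) →
                (∀ {u v} → toℕ v ≡ suc (toℕ u) → ¬ P u → P v) →
                ∀ s k (f : Fin k → Fin n) → (∀ i → toℕ (f i) ≡ toℕ i + s) → k + s ≡ n →
                (∀ {v} → toℕ v ≡ s → P v) → Spaced s (filter P? (tabulate f))
filter-spaced P? P⇒¬P ¬P⇒P s zero f f≡ refl Ps = [] ℕ.≤-refl (ℕ.n≤1+n s)
filter-spaced {n} P? P⇒¬P ¬P⇒P s (suc zero) f f≡ refl Ps
  rewrite filter-accept P? {f zero} {[]} (Ps (f≡ zero)) =
  -- With one vertex left, `n` is `suc s`, so the next position `2 + s` is exactly `suc n`.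
  f≡ zero ∷ [] (ℕ.n≤1+n _) ℕ.≤-refl
filter-spaced P? P⇒¬P ¬P⇒P s (suc (suc k)) f f≡ refl Ps
  rewrite filter-accept P? {f zero} {f (suc zero) ∷ tabulate (λ i → f (suc (suc i)))} (Ps (f≡ zero))
        | filter-reject P? {f (suc zero)} {tabulate (λ i → f (suc (suc i)))}
            (P⇒¬P (trans (f≡ (suc zero)) (cong suc (sym (f≡ zero)))) (Ps (f≡ zero))) =
  f≡ zero ∷ filter-spaced P? P⇒¬P ¬P⇒P (2 + s) k (λ i → f (suc (suc i)))
    (λ i → trans (f≡ (suc (suc i))) (sym (+-2+ (toℕ i)))) (+-2+ k)
    (λ {v} v≡ → ¬P⇒P {f (suc zero)} {v} (trans v≡ (cong suc (sym (f≡ (suc zero)))))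
      (P⇒¬P (trans (f≡ (suc zero)) (cong suc (sym (f≡ zero)))) (Ps (f≡ zero))))
  where
  +-2+ : ∀ i → i + (2 + s) ≡ 2 + i + s
  +-2+ i = trans (ℕ.+-suc i (suc s)) (cong suc (ℕ.+-suc i s))

2∤1 : ¬ 2 ∣ 1
2∤1 2∣1 with () ← ∣1⇒≡1 2∣1

2∣n⇒2∤1+n : ∀ {n} → 2 ∣ n → ¬ 2 ∣ suc n
2∣n⇒2∤1+n {n} 2∣n 2∣1+n = 2∤1 (∣m+n∣m⇒∣n (subst (2 ∣_) (ℕ.+-comm 1 n) 2∣1+n) 2∣n)

2∤n⇒2∣1+n : ∀ {n} → ¬ 2 ∣ n → 2 ∣ suc n
2∤n⇒2∣1+n {n} 2∤n with halve n
... | k , inj₁ refl = contradiction (divides-refl k) 2∤n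
... | k , inj₂ refl = divides-refl (suc k)

-- Indices count from 1 and positions from 0. The vertex at position 0 is filtered out by
-- computation, and the alternation starts at position 1, with `suc` listing the rest.
evenIndexed-spaced : ∀ n → Spaced 1 (evenIndexed (suc n))
evenIndexed-spaced n = filter-spaced (λ v → 2 ∣? index v)
  (λ { {u} eq even → subst (λ i → ¬ 2 ∣ suc i) (sym eq) (2∣n⇒2∤1+n even) })
  (λ { {u} eq odd → subst (λ i → 2 ∣ suc i) (sym eq) (2∤n⇒2∣1+n odd) })
  1 n suc (λ i → ℕ.+-comm 1 (toℕ i)) (ℕ.+-comm n 1)
  (λ eq → subst (λ i → 2 ∣ suc i) (sym eq) (divides-refl 1))

oddIndexed-spaced : ∀ n → Spaced 0 (oddIndexed n)
oddIndexed-spaced n = filter-spaced (λ v → ¬? (2 ∣? index v))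
  (λ { {u} eq odd odd′ → subst (λ i → ¬ 2 ∣ suc i) eq odd′ (2∤n⇒2∣1+n odd) })
  (λ { {u} eq ¬odd → subst (λ i → ¬ 2 ∣ suc i) (sym eq)
         (2∣n⇒2∤1+n (decidable-stable (2 ∣? index u) ¬odd)) })
  0 n id (λ i → sym (ℕ.+-identityʳ (toℕ i))) (ℕ.+-identityʳ n)
  (λ eq → subst (λ i → ¬ 2 ∣ suc i) (sym eq) 2∤1)

toℕ-lookup-spaced : ∀ {n s} {S : List (Fin n)} → Spaced s S →
                    ∀ k → toℕ (List.lookup S k) ≡ toℕ k * 2 + s
toℕ-lookup-spaced (eq ∷ _)             zero    = eq
toℕ-lookup-spaced {s = s} (_ ∷ spaced) (suc k) = trans (toℕ-lookup-spaced spaced k)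
  (trans (ℕ.+-suc (toℕ k * 2) (suc s)) (cong suc (ℕ.+-suc (toℕ k * 2) s)))

-- After its last entry the progression would continue at `length S * 2 + s`, and the constructor
-- `[]` puts this at or beyond the end of the path.
n≤length-spaced : ∀ {n s} {S : List (Fin n)} → Spaced s S → n ≤ length S * 2 + s
n≤length-spaced ([] n≤s _) = n≤s
n≤length-spaced {s = s} (_∷_ {S = S} _ spaced) = ℕ.≤-trans (n≤length-spaced spaced)
  (ℕ.≤-reflexive (trans (ℕ.+-suc (length S * 2) (suc s)) (cong suc (ℕ.+-suc (length S * 2) s))))

spaced-injective : ∀ {n s} {S : List (Fin n)} → Spaced s S → Injective _≡_ _≡_ (List.lookup S)
spaced-injective {s = s} spaced {i} {j} eq = toℕ-injective (ℕ.*-cancelʳ-≡ (toℕ i) (toℕ j) 2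
  (ℕ.+-cancelʳ-≡ s _ _ (trans (sym (toℕ-lookup-spaced spaced i))
    (trans (cong toℕ eq) (toℕ-lookup-spaced spaced j)))))

-- Paths with pendants at alternate vertices

module _ {n s} {S : List (Fin n)} (spaced : Spaced s S) (s≤1 : s ≤ 1) (2≤n : 2 ≤ n) where

  private
    m : ℕ
    m = length S

    S-injective : Injective _≡_ _≡_ (List.lookup S)
    S-injective = spaced-injective spaced

    position : ∀ k → toℕ (List.lookup S k) ≡ toℕ k * 2 + s
    position = toℕ-lookup-spaced spaced

    G : Graph
    G = attachPendants (path n) S

  0<m : 0 < m
  0<m with m | n≤length-spaced spaced
  ... | zero  | n≤s = contradiction (ℕ.≤-trans 2≤n (ℕ.≤-trans n≤s s≤1)) (ℕ.<-irrefl refl)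
  ... | suc _ | _   = s≤s z≤n

  -- A path vertex lies before the first root, is a root, lies between two consecutive roots, or
  -- lies after the last root. Outside the second case, `FirstTrue`, `NoGap` and `LastTrue`
  -- respectively provide a chosen neighbour.
  ends⇒covering : ∀ x → FirstTrue x × NoGap x × LastTrue x → Covering (path n) S S-injective x
  ends⇒covering x (first , noGap , last) v with s ℕ.≤? toℕ v
  -- Since `s ≤ 1`, this happens only for `v` at position 0 and the first root at position 1.
  ... | no  s≰v = inj₂ (k₀ , first (toℕ-fromℕ< 0<m) , inj₁ (cong suc pos₀))
    where
    k₀ = fromℕ< 0<m
    v<s = ℕ.≰⇒> s≰v
    pos₀ : toℕ (List.lookup S k₀) ≡ suc (toℕ v)
    pos₀ = trans (position k₀) (trans (cong (λ k → k * 2 + s) (toℕ-fromℕ< 0<m))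
      (ℕ.≤-antisym (ℕ.≤-trans s≤1 (s≤s z≤n)) v<s))
  ... | yes s≤v = byParity (halve (toℕ v ∸ s))
    where
    v≡ : ∀ {r} → toℕ v ∸ s ≡ r → toℕ v ≡ r + s
    v≡ eq = trans (sym (ℕ.m∸n+n≡m s≤v)) (cong (_+ s) eq)

    r<m*2 : ∀ {r} → toℕ v ∸ s ≡ r → r < m * 2
    r<m*2 {r} eq = ℕ.+-cancelʳ-< s r (m * 2)
      (subst (_< m * 2 + s) (v≡ eq) (ℕ.<-≤-trans (toℕ<n v) (n≤length-spaced spaced)))

    at : ∀ {k} (k<m : k < m) → toℕ (List.lookup S (fromℕ< k<m)) ≡ k * 2 + s
    at k<m = trans (position (fromℕ< k<m)) (cong (λ k → k * 2 + s) (toℕ-fromℕ< k<m))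

    byParity : (∃ λ k → toℕ v ∸ s ≡ k * 2 ⊎ toℕ v ∸ s ≡ suc (k * 2)) →
               (∃ λ k → v ≡ List.lookup S k) ⊎
               (∃ λ k → Vec.lookup x k ≡ true × Graph.Adj (path n) v (List.lookup S k))
    byParity (k , inj₁ eq) = inj₁ (fromℕ< k<m , toℕ-injective (trans (v≡ eq) (sym (at k<m))))
      where
      k<m = ℕ.*-cancelʳ-< 2 k m (r<m*2 eq)
    -- At an odd offset `v` comes right after root `k`, and right before root `suc k` if there is
    -- one; otherwise `k` is the last index.
    byParity (k , inj₂ eq) = between (suc k ℕ.<? m)
      where
      k<m = ℕ.*-cancelʳ-< 2 k m (ℕ.<-trans (ℕ.n<1+n (k * 2)) (r<m*2 eq))

      left : Vec.lookup x (fromℕ< k<m) ≡ true → _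
      left xₖ = inj₂ (fromℕ< k<m , xₖ , inj₂ (cong suc (trans (v≡ eq) (cong suc (sym (at k<m))))))

      between : _ → _
      between (no 1+k≮m) = left (last (trans (cong suc (toℕ-fromℕ< k<m)) (ℕ.≤-antisym k<m (ℕ.≮⇒≥ 1+k≮m))))
      between (yes 1+k<m) with noGap {fromℕ< k<m} {fromℕ< 1+k<m}
                                 (trans (toℕ-fromℕ< 1+k<m) (cong suc (sym (toℕ-fromℕ< k<m))))
      ... | inj₁ xₖ   = left xₖ
      ... | inj₂ x₁₊ₖ = inj₂ (fromℕ< 1+k<m , x₁₊ₖ , inj₁ (cong suc (trans (at 1+k<m) (cong suc (sym (v≡ eq))))))

  -- The vertex `w` halfway between roots `i` and `j` is not a root by parity, and these two are its
  -- only neighbours on the path.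
  covering⇒noGap : ∀ x → Covering (path n) S S-injective x → NoGap x
  covering⇒noGap x cov {i} {j} j≡1+i = covered (cov w)
    where
    w<n : suc (toℕ i * 2 + s) < n
    w<n = ℕ.<-trans (ℕ.n<1+n _) (subst (_< n) (trans (position j) (cong (λ k → k * 2 + s) j≡1+i)) (toℕ<n (List.lookup S j)))

    w : Fin n
    w = fromℕ< w<n

    w≡ : toℕ w ≡ suc (toℕ i * 2 + s)
    w≡ = toℕ-fromℕ< w<n

    covered : (∃ λ k → w ≡ List.lookup S k) ⊎
              (∃ λ k → Vec.lookup x k ≡ true × Graph.Adj (path n) w (List.lookup S k)) →
              Vec.lookup x i ≡ true ⊎ Vec.lookup x j ≡ true
    covered (inj₁ (k , eq)) = contradiction
      (ℕ.+-cancelʳ-≡ s _ _ (trans (sym w≡) (trans (cong toℕ eq) (position k))))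
      (1+i*2≢k*2 (toℕ i) (toℕ k))
    covered (inj₂ (k , xₖ , inj₁ eq)) = inj₂ (subst (λ k → Vec.lookup x k ≡ true) k≡j xₖ)
      where
      k≡j : k ≡ j
      k≡j = toℕ-injective (trans (ℕ.*-cancelʳ-≡ (toℕ k) (suc (toℕ i)) 2
        (ℕ.+-cancelʳ-≡ s _ _ (trans (sym (position k)) (trans (ℕ.suc-injective eq) (cong suc w≡))))) (sym j≡1+i))
    covered (inj₂ (k , xₖ , inj₂ eq)) = inj₁ (subst (λ k → Vec.lookup x k ≡ true) k≡i xₖ)
      where
      k≡i : k ≡ i
      k≡i = toℕ-injective (ℕ.*-cancelʳ-≡ (toℕ k) (toℕ i) 2
        (ℕ.+-cancelʳ-≡ s _ _ (trans (sym (position k)) (ℕ.suc-injective (trans (sym (ℕ.suc-injective eq)) w≡)))))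

  γ≡length : γ G ≡ m
  γ≡length = γ≡m (path n) S S-injective (Vec.replicate m true) (ends⇒covering (Vec.replicate m true) (allTrue-ends m))

  -- Which end letters are really forced depends on `s` and on the parity of `n`. Forcing both here
  -- and neither in `ζ≤fib` handles all cases at once, at the cost of a bounded factor.
  fib≤ζ : fib m ≤ ζ G
  fib≤ζ = subst (_≤ ζ G) (length-trueEnds m)
    (length≤ζ (path n) S S-injective γ≡length (trueEnds-unique m) (λ x x∈ → ends⇒covering x (∈trueEnds⇒ x∈)))

  ζ≤fib : ζ G ≤ fib (2 + m)
  ζ≤fib = subst (ζ G ≤_) (length-freeEnd m)
    (ζ≤length (path n) S S-injective γ≡length (λ x cov → noGap⇒∈freeEnd x (covering⇒noGap x cov)))

-- Powers of the golden ratio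

fromℕ-+ : ∀ m n → fromℕ (m ℕ.+ n) ≡ fromℕ m +ℚ fromℕ n
fromℕ-+ zero    n = sym (ℚ.+-identityˡ (fromℕ n))
fromℕ-+ (suc m) n = begin
  fromℕ (suc (m ℕ.+ n))             ≡⟨ fromℕ-suc (m ℕ.+ n) ⟩
  1ℚ +ℚ fromℕ (m ℕ.+ n)             ≡⟨ cong (1ℚ +ℚ_) (fromℕ-+ m n) ⟩
  1ℚ +ℚ (fromℕ m +ℚ fromℕ n)        ≡⟨ ℚ.+-assoc 1ℚ (fromℕ m) (fromℕ n) ⟨
  1ℚ +ℚ fromℕ m +ℚ fromℕ n          ≡⟨ cong (_+ℚ fromℕ n) (fromℕ-suc m) ⟨
  fromℕ (suc m) +ℚ fromℕ n          ∎
  where open ≡-Reasoning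

1≤φ : ∀ k → 1ℚ ≤ℚ seq φ k
1≤φ k = 0≤b-a⇒a≤b (subst (0ℚ ≤ℚ_)
  (solve 1 (λ x → con ½ :* ((x :- con (fromℕ 2)) :+ con 1ℚ) := con ½ :* (con (fromℕ 1) :+ x) :- con 1ℚ)
    refl (√5-approx k))
  (0≤a*b (ℚ.nonNegative⁻¹ ½) (ℚ.+-mono-≤ (a≤b⇒0≤b-a (2≤√5-approx k)) (0≤fromℕ 1))))

φ≤2 : ∀ k → seq φ k ≤ℚ fromℕ 2
φ≤2 k = 0≤b-a⇒a≤b (subst (0ℚ ≤ℚ_)
  (solve 1 (λ x → con ½ :* (con (fromℕ 3) :- x) := con (fromℕ 2) :- con ½ :* (con (fromℕ 1) :+ x))
    refl (√5-approx k))
  (0≤a*b (ℚ.nonNegative⁻¹ ½) (a≤b⇒0≤b-a (√5-approx≤3 k))))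

module _ (j : ℕ) where

  F F₁ : ℚ
  F  = fromℕ (fib j)
  F₁ = fromℕ (fib (suc j))

  -- The linear form in `φ` that `φ ^ᴿ suc j` reduces to, evaluated at the approximant with index
  -- `k`.
  fibφ : ℕ → ℚ
  fibφ k = F₁ *ℚ seq φ k +ℚ F

-- The factor of `2⁻ k` in the error bound below. Each further power multiplies the old error by an
-- approximant of `φ`, at most 2, and adds a new error of at most `F₁ j *ℚ ½` times `2⁻ k`.
φ^-coeff : ℕ → ℚ
φ^-coeff zero    = 1ℚ
φ^-coeff (suc j) = fromℕ 2 *ℚ φ^-coeff j +ℚ F₁ j *ℚ ½

-- φʲ⁺¹ = Fⱼ₊₁ φ + Fⱼ holds exactly in the limit; for the approximations it
-- holds up to the defect of φ² = φ + 1, which is a quarter of √5-error.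
∣φ^-fibφ∣≤ : ∀ j k → ∣ seq (φ ^ᴿ suc j) k -ℚ fibφ j k ∣ ≤ℚ φ^-coeff j *ℚ 2⁻ k
∣φ^-fibφ∣≤ zero k = ℚ.≤-trans
  (ℚ.≤-reflexive (cong ∣_∣ (solve 1 (λ q → q :* con 1ℚ :- (con (fromℕ 1) :* q :+ con (fromℕ 0)) := con 0ℚ) refl (seq φ k))))
  (0≤a*b (ℚ.nonNegative⁻¹ 1ℚ) (0≤2⁻ k))
∣φ^-fibφ∣≤ (suc j) k = begin
  ∣ q *ℚ P -ℚ (fromℕ (fib (suc j) ℕ.+ fib j) *ℚ q +ℚ F₁ j) ∣
    ≡⟨ cong (λ c → ∣ q *ℚ P -ℚ (c *ℚ q +ℚ F₁ j) ∣) (fromℕ-+ (fib (suc j)) (fib j)) ⟩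
  ∣ q *ℚ P -ℚ ((F₁ j +ℚ F j) *ℚ q +ℚ F₁ j) ∣
    -- Adding and subtracting `a * q * q` isolates `q` times the previous error and leaves
    -- `a * (q * q - q - 1)`, where the bracket equals `(x * x - 5) / 4`.
    ≡⟨ cong ∣_∣ (solve 4 (λ x P a b → let q = con ½ :* (con (fromℕ 1) :+ x) in
         q :* P :- ((a :+ b) :* q :+ a) :=
         q :* (P :- (a :* q :+ b)) :+ (a :* con ½) :* (con (-ℚ ½) :* (con (fromℕ 5) :- x :* x)))
         refl (√5-approx k) P (F₁ j) (F j)) ⟩
  ∣ q *ℚ (P -ℚ fibφ j k) +ℚ (F₁ j *ℚ ½) *ℚ ((-ℚ ½) *ℚ √5-error k) ∣
    ≤⟨ ℚ.∣p+q∣≤∣p∣+∣q∣ (q *ℚ (P -ℚ fibφ j k)) _ ⟩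
  ∣ q *ℚ (P -ℚ fibφ j k) ∣ +ℚ ∣ (F₁ j *ℚ ½) *ℚ ((-ℚ ½) *ℚ √5-error k) ∣
    ≤⟨ ℚ.+-mono-≤ (*-mono-∣∣ {q} ∣q∣≤2 (∣φ^-fibφ∣≤ j k)) (*-mono-∣∣ {F₁ j *ℚ ½} ∣F₁/2∣≤ ∣err/2∣≤) ⟩
  fromℕ 2 *ℚ (φ^-coeff j *ℚ 2⁻ k) +ℚ (F₁ j *ℚ ½) *ℚ (1ℚ *ℚ 2⁻ k)
    ≡⟨ solve 4 (λ t A h f → t :* (A :* h) :+ f :* (con 1ℚ :* h) := (t :* A :+ f) :* h)
         refl (fromℕ 2) (φ^-coeff j) (2⁻ k) (F₁ j *ℚ ½) ⟩
  φ^-coeff (suc j) *ℚ 2⁻ k ∎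
  where
  open ℚ.≤-Reasoning
  q = seq φ k
  P = seq (φ ^ᴿ suc j) k

  ∣q∣≤2 : ∣ q ∣ ≤ℚ fromℕ 2
  ∣q∣≤2 = ℚ.≤-trans (ℚ.≤-reflexive (ℚ.0≤p⇒∣p∣≡p (ℚ.≤-trans (0≤fromℕ 1) (1≤φ k)))) (φ≤2 k)

  ∣F₁/2∣≤ : ∣ F₁ j *ℚ ½ ∣ ≤ℚ F₁ j *ℚ ½
  ∣F₁/2∣≤ = ℚ.≤-reflexive (ℚ.0≤p⇒∣p∣≡p (0≤a*b (0≤fromℕ (fib (suc j))) (ℚ.nonNegative⁻¹ ½)))

  ∣err/2∣≤ : ∣ (-ℚ ½) *ℚ √5-error k ∣ ≤ℚ 1ℚ *ℚ 2⁻ k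
  ∣err/2∣≤ = *-mono-∣∣ { -ℚ ½} (from-yes (∣ -ℚ ½ ∣ ℚ.≤? 1ℚ)) (∣√5-error∣≤2⁻ k)

0<φ^-coeff : ∀ j → 0ℚ <ℚ φ^-coeff j
0<φ^-coeff zero    = ℚ.positive⁻¹ 1ℚ
0<φ^-coeff (suc j) = ℚ.+-mono-<-≤
  (ℚ.*-monoʳ-<-pos (fromℕ 2) (0<φ^-coeff j))
  (0≤a*b (0≤fromℕ (fib (suc j))) (ℚ.nonNegative⁻¹ ½))

φ^-close : ∀ j {ε} → 0ℚ <ℚ ε → ∃ λ N → ∀ {k} → N ℕ.≤ k → ∣ seq (φ ^ᴿ suc j) k -ℚ fibφ j k ∣ <ℚ ε
-- The witness `_` is the denominator of `δ`, as dictated by `2⁻<ε`.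
φ^-close j {ε} 0<ε = let δ , 0<δ , Aδ≡ε = divide (0<φ^-coeff j) 0<ε in _ , λ {k} N≤k → begin-strict
  ∣ seq (φ ^ᴿ suc j) k -ℚ fibφ j k ∣   ≤⟨ ∣φ^-fibφ∣≤ j k ⟩
  φ^-coeff j *ℚ 2⁻ k                   <⟨ ℚ.*-monoʳ-<-pos (φ^-coeff j) {{positive (0<φ^-coeff j)}} (2⁻<ε 0<δ N≤k) ⟩
  φ^-coeff j *ℚ δ                      ≡⟨ Aδ≡ε ⟩
  ε                                    ∎
  where open ℚ.≤-Reasoning

-- The constants 1/3 and 2

⅓ : ℚ
⅓ = ℤ.+ 1 /ℚ 3

-- From `φ ≤ 2` and `fib j ≤ fib (suc j)`, the form `fibφ` is at most three times `fib (suc j)`;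
-- hence the constant 1/3.
⅓φ^≤ : ∀ {j N} → fib (suc j) ℕ.≤ N → fromℚ ⅓ *ᴿ φ ^ᴿ suc j ≤ᴿ fromℕᴿ N
⅓φ^≤ {j} {N} F₁≤N {ε} 0<ε =
  -- The tolerance is `3 * ε` because the factor 1/3 scales it back to `ε`.
  let M , close = φ^-close j {fromℕ 3 *ℚ ε} (ℚ.*-monoʳ-<-pos (fromℕ 3) 0<ε) in
  M , λ {k} M≤k → let q = seq φ k ; P = seq (φ ^ᴿ suc j) k in begin-strict
    ⅓ *ℚ P
      ≡⟨ cong (⅓ *ℚ_) (solve 2 (λ P T → P := P :- T :+ T) refl P (fibφ j k)) ⟩
    ⅓ *ℚ (P -ℚ fibφ j k +ℚ fibφ j k)
      <⟨ ℚ.*-monoʳ-<-pos ⅓ (ℚ.+-mono-<-≤ (ℚ.≤-<-trans (a≤∣a∣ (P -ℚ fibφ j k)) (close M≤k))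
           (ℚ.+-mono-≤ (ℚ.*-monoˡ-≤-nonNeg (F₁ j) {{nonNegative (0≤fromℕ (fib (suc j)))}} (φ≤2 k))
                       (fromℕ-mono (fib≤fib-suc j)))) ⟩
    ⅓ *ℚ (fromℕ 3 *ℚ ε +ℚ (F₁ j *ℚ fromℕ 2 +ℚ F₁ j))
      ≡⟨ solve 2 (λ ε a → con ⅓ :* (con (fromℕ 3) :* ε :+ (a :* con (fromℕ 2) :+ a)) := a :+ ε) refl ε (F₁ j) ⟩
    F₁ j +ℚ ε
      ≤⟨ ℚ.+-monoˡ-≤ ε (fromℕ-mono F₁≤N) ⟩
    fromℕ N +ℚ ε ∎
  where open ℚ.≤-Reasoning

-- Unfolding gives `fib (3 + j)` as twice `fib (suc j)` plus `fib j`, which `1 ≤ φ` bounds by twice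
-- `fibφ`; hence the constant 2.
≤2φ^ : ∀ {j N} → N ℕ.≤ fib (3 ℕ.+ j) → fromℕᴿ N ≤ᴿ fromℕᴿ 2 *ᴿ φ ^ᴿ suc j
≤2φ^ {j} {N} N≤F₃ {ε} 0<ε =
  -- Half of `ε` suffices because the factor 2 doubles the error.
  let M , close = φ^-close j (0<½*ε 0<ε) in
  M , λ {k} M≤k → let q = seq φ k ; P = seq (φ ^ᴿ suc j) k ; a = F₁ j ; b = F j in begin-strict
    fromℕ N
      ≤⟨ fromℕ-mono N≤F₃ ⟩
    fromℕ (fib (suc j) ℕ.+ fib j ℕ.+ fib (suc j))
      ≡⟨ trans (fromℕ-+ (fib (suc j) ℕ.+ fib j) (fib (suc j))) (cong (_+ℚ a) (fromℕ-+ (fib (suc j)) (fib j))) ⟩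
    a +ℚ b +ℚ a
      ≡⟨ solve 2 (λ a b → a :+ b :+ a := con (fromℕ 2) :* (a :* con 1ℚ) :+ (b :+ con 0ℚ)) refl a b ⟩
    fromℕ 2 *ℚ (a *ℚ 1ℚ) +ℚ (b +ℚ 0ℚ)
      ≤⟨ ℚ.+-mono-≤ (ℚ.*-monoˡ-≤-nonNeg (fromℕ 2) (ℚ.*-monoˡ-≤-nonNeg a {{nonNegative (0≤fromℕ (fib (suc j)))}} (1≤φ k)))
                    (ℚ.+-monoʳ-≤ b (0≤fromℕ (fib j))) ⟩
    fromℕ 2 *ℚ (a *ℚ q) +ℚ (b +ℚ b)
      ≡⟨ solve 4 (λ a b q P → con (fromℕ 2) :* (a :* q) :+ (b :+ b) :=
                   con (fromℕ 2) :* P :+ con (fromℕ 2) :* (:- (P :- (a :* q :+ b)))) refl a b q P ⟩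
    fromℕ 2 *ℚ P +ℚ fromℕ 2 *ℚ (-ℚ (P -ℚ fibφ j k))
      <⟨ ℚ.+-monoʳ-< (fromℕ 2 *ℚ P) (ℚ.*-monoʳ-<-pos (fromℕ 2)
           (ℚ.≤-<-trans (a≤∣a∣ (-ℚ (P -ℚ fibφ j k)))
             (ℚ.≤-<-trans (ℚ.≤-reflexive (ℚ.∣-p∣≡∣p∣ (P -ℚ fibφ j k))) (close M≤k)))) ⟩
    fromℕ 2 *ℚ P +ℚ fromℕ 2 *ℚ (½ *ℚ ε)
      ≡⟨ cong (fromℕ 2 *ℚ P +ℚ_) (solve 1 (λ ε → con (fromℕ 2) :* (con ½ :* ε) := ε) refl ε) ⟩
    fromℕ 2 *ℚ P +ℚ ε ∎
  where open ℚ.≤-Reasoning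

0<⅓ : 0ᴿ <ᴿ fromℚ ⅓
0<⅓ = ½ *ℚ ½ , ℚ.positive⁻¹ (½ *ℚ ½) , 0 , λ _ → from-yes (fromℕ 0 +ℚ ½ *ℚ ½ ℚ.<? ⅓)

⅓≤2 : fromℚ ⅓ ≤ᴿ fromℕᴿ 2
⅓≤2 0<ε = 0 , λ _ → ℚ.+-mono-≤-< (from-yes (⅓ ℚ.≤? fromℕ 2)) 0<ε

-- Positivity of `m` matters: at `m = 0` the lower bound `fib 0` would allow `N = 0`, while the
-- power of `φ` is 1.
fib-bounds⇒φ^-bounds : ∀ {m N} → 0 < m → fib m ≤ N → N ≤ fib (2 + m) →
  fromℚ ⅓ *ᴿ φ ^ᴿ m ≤ᴿ fromℕᴿ N × fromℕᴿ N ≤ᴿ fromℕᴿ 2 *ᴿ φ ^ᴿ m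
fib-bounds⇒φ^-bounds {suc j} _ fib≤N N≤fib = ⅓φ^≤ {j} fib≤N , ≤2φ^ {j} N≤fib

spaced⇒φ^-bounds : ∀ {n s} {S : List (Fin n)} → Spaced s S → s ≤ 1 → 2 ≤ n →
  let G = attachPendants (path n) S in
  fromℚ ⅓ *ᴿ φ ^ᴿ γ G ≤ᴿ fromℕᴿ (ζ G) × fromℕᴿ (ζ G) ≤ᴿ fromℕᴿ 2 *ᴿ φ ^ᴿ γ G
spaced⇒φ^-bounds {n} {S = S} spaced s≤1 2≤n = subst
  (λ g → fromℚ ⅓ *ᴿ φ ^ᴿ g ≤ᴿ fromℕᴿ (ζ G) × fromℕᴿ (ζ G) ≤ᴿ fromℕᴿ 2 *ᴿ φ ^ᴿ g)
  (sym (γ≡length spaced s≤1 2≤n))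
  (fib-bounds⇒φ^-bounds (0<m spaced s≤1 2≤n) (fib≤ζ spaced s≤1 2≤n) (ζ≤fib spaced s≤1 2≤n))
  where G = attachPendants (path n) S

corollary9 : ∃₂ λ (c C : ℝ) → 0ᴿ <ᴿ c × c ≤ᴿ C ×
    ((n : ℕ) → 2 ≤ n →
    (c *ᴿ φ ^ᴿ γ (E n) ≤ᴿ fromℕᴿ (ζ (E n)) × fromℕᴿ (ζ (E n)) ≤ᴿ C *ᴿ φ ^ᴿ γ (E n)) ×
    (c *ᴿ φ ^ᴿ γ (O n) ≤ᴿ fromℕᴿ (ζ (O n)) × fromℕᴿ (ζ (O n)) ≤ᴿ C *ᴿ φ ^ᴿ γ (O n)))
corollary9 = fromℚ ⅓ , fromℕᴿ 2 , 0<⅓ , ⅓≤2 , λ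
  -- The first pendant sits at position 1 for `E n` and at position 0 for `O n`; both satisfy
  -- `s ≤ 1`.
  { n@(suc n-1) 2≤n → spaced⇒φ^-bounds (evenIndexed-spaced n-1) ℕ.≤-refl 2≤n
                    , spaced⇒φ^-bounds (oddIndexed-spaced n) z≤n 2≤n }
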